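{- Let $G$ be a $(P_5, C_4)$-free graph and let $\ell \ge \chi(G)+1$ be an integer. Then $\mathcal{R}_\ell(G)$ is connected.
   Context: All graphs are finite and simple. A $k$-colouring of $G$ is a map $\alpha: V(G)\to\{1,\dots,k\}$ with $\alpha(u)\neq\alpha(v)$ for every edge $uv$; $\chi(G)$ is the chromatic number. The reconfiguration graph $\mathcal{R}_k(G)$ has the $k$-colourings of $G$ as vertices, two being adjacent if they differ on exactly one vertex. A graph is $(H_1,H_2)$-free if it has no induced subgraph isomorphic to $H_1$ or $H_2$; $P_5$ is the path on 5 vertices and $C_4$ the 4-cycle. -}

module Defs where

open import Data.Fin.Base using (Fin; toℕ; finToFun; funToFin)
open import Data.Fin.Properties using (_≟_; any?; all?; finToFun-funToFin)
open import Data.Nat.Base using (ℕ; zero; suc; _≤_; z≤n; s≤s; _^_)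
import Data.Nat.Properties as ℕ
open import Data.Product.Base using (_×_; _,_; ∃; ∃-syntax; proj₁; proj₂)
open import Data.Product using (∃!)
open import Data.Sum.Base using (_⊎_; inj₁; inj₂; swap; [_,_]′)
open import Function.Base using (_∘_; id)
open import Function.Bundles using (_⇔_)
open import Function.Definitions using (Injective)
open import Level using (0ℓ)
open import Relation.Binary.Core using (Rel)
open import Relation.Binary.Definitions using (Decidable; Symmetric; Irreflexive)
open import Relation.Binary.PropositionalEquality.Core
  using (_≡_; _≢_; _≗_; refl; sym; trans)
open import Relation.Nullary.Decidable.Core
  using (Dec; yes; no; True; toWitness; map′; _×-dec_; _⊎-dec_; _→-dec_; ¬?)
open import Relation.Nullary.Negation.Core using (¬_; contradiction)
import Relation.Unary as U

-- A finite simple graph; decidability of adjacency is automatic classically.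
record Graph (n : ℕ) : Set₁ where
  field
    _∼_    : Rel (Fin n) 0ℓ
    _∼?_   : Decidable _∼_
    symm   : Symmetric _∼_
    irrefl : Irreflexive _≡_ _∼_

underlying : ∀ {n} (_⇒_ : Rel (Fin n) 0ℓ) → Decidable _⇒_ →
             Irreflexive _≡_ _⇒_ → Graph n
underlying _⇒_ _⇒?_ irr = record
  { _∼_    = λ i j → i ⇒ j ⊎ j ⇒ i
  ; _∼?_   = λ i j → (i ⇒? j) ⊎-dec (j ⇒? i)
  ; symm   = swap
  ; irrefl = λ i≡j → [ irr i≡j , irr (sym i≡j) ]′
  }

P : ∀ n → Graph n
P n = underlying (λ i j → toℕ j ≡ suc (toℕ i))
                 (λ i j → toℕ j ℕ.≟ suc (toℕ i))
                 (λ { refl → ℕ.1+n≢n ∘ sym })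

C : ∀ n {3≤n : True (3 ℕ.≤? n)} → Graph n
C n {3≤n} = underlying
  (λ i j → toℕ j ≡ suc (toℕ i) ⊎ (suc (toℕ i) ≡ n × toℕ j ≡ 0))
  (λ i j → (toℕ j ℕ.≟ suc (toℕ i)) ⊎-dec ((suc (toℕ i) ℕ.≟ n) ×-dec (toℕ j ℕ.≟ 0)))
  (λ { refl → [ ℕ.1+n≢n ∘ sym , (λ (last , first) → not-single (toWitness 3≤n) last first) ]′ })
  where
  not-single : ∀ {m i} → 3 ≤ m → suc i ≡ m → i ≢ 0
  not-single (s≤s ()) refl refl

InducedSubgraph : ∀ {m n} → Graph m → Graph n → Set
InducedSubgraph {m} {n} H G =
  ∃[ f ] Injective _≡_ _≡_ f × (∀ (i j : Fin m) → (i H.∼ j) ⇔ (f i G.∼ f j))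
  where
  module H = Graph H
  module G = Graph G

Free : ∀ {m₁ m₂ n} → Graph m₁ → Graph m₂ → Graph n → Set
Free H₁ H₂ G = ¬ InducedSubgraph H₁ G × ¬ InducedSubgraph H₂ G

Proper : ∀ {n k} → Graph n → (Fin n → Fin k) → Set
Proper G α = ∀ u v → u ∼ v → α u ≢ α v
  where open Graph G

record Colouring {n} (G : Graph n) (k : ℕ) : Set where
  field
    colour : Fin n → Fin k
    proper : Proper G colour

open Colouring public

proper? : ∀ {n k} (G : Graph n) (α : Fin n → Fin k) → Dec (Proper G α)
proper? G α = all? λ u → all? λ v → (u ∼? v) →-dec ¬? (α u ≟ α v)
  where open Graph G

colouring? : ∀ {n} (G : Graph n) → U.Decidable (Colouring G)
colouring? {n} G k = map′ from to (any? {n = k ^ n} (proper? G ∘ finToFun))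
  where
  from : (∃ λ c → Proper G (finToFun {k} {n} c)) → Colouring G k
  from (c , p) = record { colour = finToFun c ; proper = p }

  to : Colouring G k → ∃ λ c → Proper G (finToFun {k} {n} c)
  to α = funToFin (colour α) , λ u v u∼v eq → proper α u v u∼v
    (trans (sym (finToFun-funToFin (colour α) u))
           (trans eq (finToFun-funToFin (colour α) v)))

discrete : ∀ {n} (G : Graph n) → Colouring G n
discrete G = record { colour = id ; proper = λ u v u∼v u≡v → irrefl u≡v u∼v }
  where open Graph G

Least : (ℕ → Set) → ℕ → Set
Least Q m = Q m × (∀ j → Q j → m ≤ j)

least : ∀ {Q : ℕ → Set} → U.Decidable Q → ∀ n → Q n → ∃ (Least Q)
least Q? zero    q = 0 , q , λ _ _ → z≤n
least Q? (suc n) q with Q? 0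
... | yes q₀ = 0 , q₀ , λ _ _ → z≤n
... | no ¬q₀ with least (Q? ∘ suc) n q
...   | m , qₘ , min = suc m , qₘ , λ where
        zero    q₀ → contradiction q₀ ¬q₀
        (suc j) qⱼ → s≤s (min j qⱼ)

chromatic : ∀ {n} (G : Graph n) → ∃ (Least (Colouring G))
chromatic {n} G = least (colouring? G) n (discrete G)

χ : ∀ {n} → Graph n → ℕ
χ G = proj₁ (chromatic G)

χ-least : ∀ {n} (G : Graph n) → Least (Colouring G) (χ G)
χ-least G = proj₂ (chromatic G)

module Reconfiguration {n} (G : Graph n) (k : ℕ) where

  -- Colourings are identified when they agree as maps; propositional equality
  -- of the records would need function extensionality.
  _≈_ : Rel (Colouring G k) 0ℓ
  α ≈ β = colour α ≗ colour β

  Adjacent : Rel (Colouring G k) 0ℓ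
  Adjacent α β = ∃! _≡_ λ v → colour α v ≢ colour β v

  data Walk : Rel (Colouring G k) 0ℓ where
    stop : ∀ {α β} → α ≈ β → Walk α β
    step : ∀ {α β γ} → Adjacent α β → Walk β γ → Walk α γ

  Connected : Set
  Connected = ∀ α β → Walk α β

{-# OPTIONS --safe #-}

-- Every nonempty (P₅, C₄)-free graph has a nonempty vertex set T whose outside neighbours
-- form a clique complete to T, such that no three vertices of T are independent: T is a
-- simplicial vertex, or the clique blow-up of an induced C₅. Delete T and induct. Fix a
-- χ-colouring γ. Since γ-classes in T have at most two vertices and a colour is to spare,
-- any colouring can be made constant on the γ-classes of T by recolouring T only. Such a
-- colouring leaves a colour unused on T and its neighbours, which lets T get out of the way
-- of each recolouring step of the rest of the graph, and finally lets T be permuted into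
-- its target colours.

module Submission where

open import Defs
open import Data.Bool.Base using (if_then_else_)
open import Data.Empty using (⊥; ⊥-elim)
open import Data.Fin.Base using (Fin; zero; suc; _<_; combine; remQuot)
open import Data.Fin.Patterns using (0F; 1F; 2F; 3F; 4F)
open import Data.Fin.Properties
  using (_≟_; _<?_; <-cmp; <-asym; <⇒≢; any?; all?; pigeonhole; combine-injective; combine-remQuot)
open import Data.List.Base using ([]; _∷_; length; filter; allFin)
open import Data.List.Membership.Propositional using (_∈_)
open import Data.List.Membership.Propositional.Properties using (∈-allFin)
open import Data.List.Relation.Unary.Any using (here; there)
open import Data.Nat using (ℕ; _+_; _≥_)
open import Data.Nat.Base as ℕ using (z≤n; s≤s)
open import Data.Nat.Induction using (<-wellFounded)
import Data.Nat.Properties as ℕ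
open import Data.Product.Base using (_×_; _,_; ∃; ∃₂; proj₁; proj₂; uncurry)
open import Data.Sum.Base using (_⊎_; inj₁; inj₂)
open import Data.Unit.Base using (⊤; tt)
open import Data.Vec.Base using ([]; _∷_; lookup)
open import Function.Base using (_∘_; case_of_; const)
open import Function.Bundles using (mk⇔)
open import Induction.WellFounded using (Acc; acc)
open import Level using (0ℓ)
open import Relation.Binary.Construct.Closure.ReflexiveTransitive
  using (Star; ε; _◅_; _◅◅_; reverse)
open import Relation.Binary.Definitions using (tri<; tri≈; tri>)
open import Relation.Binary.PropositionalEquality
  using (_≡_; _≢_; refl; sym; trans; cong; cong₂; subst; ≢-sym)
open import Relation.Nullary.Decidable
  using (Dec; yes; no; does; dec-true; dec-false; ¬?; _×-dec_; _⊎-dec_; _→-dec_;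
         decidable-stable; from-yes)
open import Relation.Nullary.Negation using (¬_; contradiction)
open import Relation.Unary using (Pred; Decidable; _⊆_)

-- The obstacle is that a colouring may use all ℓ colours on T and its neighbours although ℓ exceeds
-- χ: with four colours a five-cycle can be coloured 1, 2, 3, 4, 3. Then T has no fresh colour to
-- retreat to. Imitating γ cures this, since a colouring constant on γ-classes needs no more colours
-- there than γ has. The set T is found in the manner of Dirac's proof that chordal graphs have
-- simplicial vertices. Take a vertex v and a set K, in effect connected, with no edge between them.
-- Enlarge K, letting v change, until every vertex beyond the boundary of K is complete to that
-- boundary. If boundary vertices a and b are not adjacent, P₅-freeness joins them through K by one
-- or two vertices. One would give a C₄ with v; two give an induced C₅ with v. Otherwise the
-- boundary is a clique, and induction applies to the part beyond it, which contains v.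

-- Sizes of decidable sets, and maps overwritten on a set.

module _ {X : Set} {P Q : Pred X 0ℓ} (P? : Decidable P) (Q? : Decidable Q) (P⊆Q : P ⊆ Q) where

  length-filter-mono : ∀ xs → length (filter P? xs) ℕ.≤ length (filter Q? xs)
  length-filter-mono [] = z≤n
  length-filter-mono (x ∷ xs) with P? x | Q? x
  ... | yes _ | yes _ = s≤s (length-filter-mono xs)
  ... | yes p | no ¬q = contradiction (P⊆Q p) ¬q
  ... | no _  | yes _ = ℕ.m≤n⇒m≤1+n (length-filter-mono xs)
  ... | no _  | no _  = length-filter-mono xs

  length-filter-strict : ∀ {x xs} → x ∈ xs → Q x → ¬ P x →
                         length (filter P? xs) ℕ.< length (filter Q? xs)
  length-filter-strict {x} {y ∷ xs} (here refl) q ¬p with P? x | Q? x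
  ... | yes p | _     = contradiction p ¬p
  ... | no _  | yes _ = s≤s (length-filter-mono xs)
  ... | no _  | no ¬q = contradiction q ¬q
  length-filter-strict {x} {y ∷ xs} (there x∈xs) q ¬p with P? y | Q? y
  ... | yes _ | yes _ = s≤s (length-filter-strict x∈xs q ¬p)
  ... | yes p | no ¬q = contradiction (P⊆Q p) ¬q
  ... | no _  | yes _ = ℕ.m≤n⇒m≤1+n (length-filter-strict x∈xs q ¬p)
  ... | no _  | no _  = length-filter-strict x∈xs q ¬p

size : ∀ {n} {P : Pred (Fin n) 0ℓ} → Decidable P → ℕ
size P? = length (filter P? (allFin _))

size-strict : ∀ {n} {P Q : Pred (Fin n) 0ℓ} (P? : Decidable P) (Q? : Decidable Q) →
              P ⊆ Q → ∀ {x} → Q x → ¬ P x → size P? ℕ.< size Q?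
size-strict P? Q? P⊆Q {x} = length-filter-strict P? Q? P⊆Q (∈-allFin x)

module _ {n} {X : Set} {P : Pred (Fin n) 0ℓ} (P? : Decidable P) (α β : Fin n → X) where

  overwrite : Fin n → X
  overwrite u = if does (P? u) then β u else α u

  overwrite-in : ∀ {u} → P u → overwrite u ≡ β u
  overwrite-in {u} p rewrite dec-true (P? u) p = refl

  overwrite-out : ∀ {u} → ¬ P u → overwrite u ≡ α u
  overwrite-out {u} ¬p rewrite dec-false (P? u) ¬p = refl

  overwrite-cong : ∀ {u v} → (P u → P v) → (P v → P u) → α u ≡ α v → β u ≡ β v →
                   overwrite u ≡ overwrite v
  overwrite-cong {u} {v} u⇒v v⇒u αeq βeq with P? u | P? v
  ... | yes _ | yes _ = βeq
  ... | yes p | no ¬p = contradiction (u⇒v p) ¬p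
  ... | no ¬p | yes p = contradiction (v⇒u p) ¬p
  ... | no _  | no _  = αeq

  overwrite-avoids : ∀ {u x} → (P u → β u ≢ x) → (¬ P u → α u ≢ x) → overwrite u ≢ x
  overwrite-avoids {u} inside outside with P? u
  ... | yes p = inside p
  ... | no ¬p = outside ¬p

-- Counting colours against γ-classes of at most two vertices.

module Counting {n k ℓ} {W : Pred (Fin n) 0ℓ} (W? : Decidable W)
  (γ : Fin n → Fin k) (α : Fin n → Fin ℓ) (k<ℓ : k ℕ.< ℓ)
  (γ-small : ∀ {u v w} → W u → W v → W w → u ≢ v → u ≢ w → v ≢ w → γ u ≡ γ v → γ u ≢ γ w)
  where

  Twin : ∀ {m} → (Fin n → Fin m) → Fin n → Fin n → Set
  Twin δ u v = W v × u ≢ v × δ u ≡ δ v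

  twin? : ∀ {m} (δ : Fin n → Fin m) u → Decidable (Twin δ u)
  twin? δ u v = W? v ×-dec ¬? (u ≟ v) ×-dec (δ u ≟ δ v)

  -- Were every colour used, each colour c would yield two vertices of W coloured c (one of
  -- them taken twice if it has no α-twin). A γ-class has two slots, and its vertices occupy
  -- one each, or both if there is only one, so this injects Fin ℓ × Fin 2 into Fin k × Fin 2.
  module _ (twins : ∀ {u} → W u → ∃ (Twin γ u) → ∃ (Twin α u))
           (used : ∀ c → ∃ λ u → W u × α u ≡ c) where

    pick : Fin ℓ → Fin 2 → Fin n
    pick c zero = proj₁ (used c)
    pick c (suc _) with any? (twin? α (proj₁ (used c)))
    ... | yes (v , _) = v
    ... | no _        = proj₁ (used c)

    pick-W : ∀ c b → W (pick c b)
    pick-W c zero = proj₁ (proj₂ (used c))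
    pick-W c (suc _) with any? (twin? α (proj₁ (used c)))
    ... | yes (v , w , _) = w
    ... | no _            = proj₁ (proj₂ (used c))

    pick-colour : ∀ c b → α (pick c b) ≡ c
    pick-colour c zero = proj₂ (proj₂ (used c))
    pick-colour c (suc _) with any? (twin? α (proj₁ (used c)))
    ... | yes (v , _ , _ , eq) = trans (sym eq) (proj₂ (proj₂ (used c)))
    ... | no _                 = proj₂ (proj₂ (used c))

    pick-distinct : ∀ c → ∃ (Twin γ (pick c zero)) → pick c zero ≢ pick c (suc zero)
    pick-distinct c tw with any? (twin? α (proj₁ (used c)))
    ... | yes (v , _ , u≢v , _) = u≢v
    ... | no ¬tw = contradiction (twins (proj₁ (proj₂ (used c))) tw) ¬tw

    -- The order on `Fin n` settles which of two twins takes which slot; for a lone vertex the copy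
    -- index `b` passes through.
    slot : Fin n → Fin 2 → Fin 2
    slot u b with any? (twin? γ u) | any? (λ v → twin? γ u v ×-dec (v <? u))
    ... | no _  | _     = b
    ... | yes _ | yes _ = suc zero
    ... | yes _ | no _  = zero

    slot-alone : ∀ u b → ¬ ∃ (Twin γ u) → slot u b ≡ b
    slot-alone u b ¬tw with any? (twin? γ u) | any? (λ v → twin? γ u v ×-dec (v <? u))
    ... | no _  | _     = refl
    ... | yes tw | _ = contradiction tw ¬tw

    slot-upper : ∀ u v b → Twin γ u v → v < u → slot u b ≡ suc zero
    slot-upper u v b tw v<u with any? (twin? γ u) | any? (λ v → twin? γ u v ×-dec (v <? u))
    ... | no ¬tw | _     = contradiction (v , tw) ¬tw
    ... | yes _ | yes _ = refl
    ... | yes _ | no ¬s  = contradiction (v , tw , v<u) ¬s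

    slot-lower : ∀ u v b → W u → Twin γ u v → u < v → slot u b ≡ zero
    slot-lower u v b Wu tw u<v with any? (twin? γ u) | any? (λ v → twin? γ u v ×-dec (v <? u))
    ... | no ¬tw | _     = contradiction (v , tw) ¬tw
    ... | yes _ | no _  = refl
    ... | yes _ | yes (w , (Ww , u≢w , eq′) , w<u) = let (Wv , u≢v , eq) = tw in
      contradiction eq′ (γ-small Wu Wv Ww u≢v u≢w (λ { refl → <-asym u<v w<u }) eq)

    slot-injective : ∀ {u v} b b′ → W u → W v → γ u ≡ γ v → slot u b ≡ slot v b′ → u ≡ v
    slot-injective {u} {v} b b′ Wu Wv eq seq with <-cmp u v
    ... | tri≈ _ u≡v _ = u≡v
    ... | tri< u<v u≢v _ = contradiction
      (trans (sym (slot-lower u v b Wu (Wv , u≢v , eq) u<v))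
             (trans seq (slot-upper v u b′ (Wu , ≢-sym u≢v , sym eq) u<v))) λ ()
    ... | tri> _ u≢v v<u = contradiction
      (trans (sym (slot-lower v u b′ Wv (Wu , ≢-sym u≢v , sym eq) v<u))
             (trans (sym seq) (slot-upper u v b (Wv , u≢v , eq) v<u))) λ ()

    code : Fin ℓ → Fin 2 → Fin (k ℕ.* 2)
    code c b = combine (γ (pick c b)) (slot (pick c b) b)

    -- Both copies of a colour coincide only at a vertex without a γ-twin, and there `slot` returns
    -- the copy index itself.
    pick-injective : ∀ c b b′ → pick c b ≡ pick c b′ →
                     slot (pick c b) b ≡ slot (pick c b′) b′ → b ≡ b′
    pick-injective c b b′ peq seq with any? (twin? γ (pick c zero))
    pick-injective c zero zero peq seq | _ = refl
    pick-injective c (suc zero) (suc zero) peq seq | _ = refl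
    pick-injective c zero (suc zero) peq seq | yes tw = contradiction peq (pick-distinct c tw)
    pick-injective c (suc zero) zero peq seq | yes tw = contradiction (sym peq) (pick-distinct c tw)
    pick-injective c zero (suc zero) peq seq | no ¬tw =
      trans (sym (slot-alone _ zero ¬tw))
            (trans seq (slot-alone _ (suc zero) (subst (λ u → ¬ ∃ (Twin γ u)) peq ¬tw)))
    pick-injective c (suc zero) zero peq seq | no ¬tw =
      trans (sym (slot-alone _ (suc zero) (subst (λ u → ¬ ∃ (Twin γ u)) (sym peq) ¬tw)))
            (trans seq (slot-alone _ zero ¬tw))

    code-injective : ∀ c b c′ b′ → code c b ≡ code c′ b′ → c ≡ c′ × b ≡ b′
    code-injective c b c′ b′ eq
      with combine-injective (γ (pick c b)) (slot (pick c b) b) _ _ eq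
    ... | γeq , seq with slot-injective b b′ (pick-W c b) (pick-W c′ b′) γeq seq
    ... | peq with trans (sym (pick-colour c b)) (trans (cong α peq) (pick-colour c′ b′))
    ... | refl = refl , pick-injective c b b′ peq seq

    impossible : ⊥
    impossible with pigeonhole (ℕ.*-monoˡ-< 2 k<ℓ) (λ i → uncurry code (remQuot {ℓ} 2 i))
    ... | i , j , i<j , eq with code-injective _ _ _ _ eq
    ... | eq₁ , eq₂ = contradiction i≡j (<⇒≢ i<j)
      where
      i≡j : i ≡ j
      i≡j = trans (sym (combine-remQuot {ℓ} 2 i))
            (trans (cong₂ combine eq₁ eq₂) (combine-remQuot {ℓ} 2 j))

  unused : (∀ {u} → W u → ∃ (Twin γ u) → ∃ (Twin α u)) → ∃ λ c → ∀ {u} → W u → α u ≢ c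
  unused twins with any? (λ c → all? λ u → W? u →-dec ¬? (α u ≟ c))
  ... | yes (c , free) = c , λ {u} → free u
  ... | no ¬free = ⊥-elim (impossible twins used)
    where
    used : ∀ c → ∃ λ u → W u × α u ≡ c
    used c with any? (λ u → W? u ×-dec (α u ≟ c))
    ... | yes found = found
    ... | no ¬found = contradiction (c , λ u w eq → ¬found (u , w , eq)) ¬free

-- Removable sets and recolouring within an induced subgraph.

module _ {n} (G : Graph n) where
  open Graph G

  -- W consists of T and its neighbours in A.
  record Removable (A : Pred (Fin n) 0ℓ) : Set₁ where
    field
      T W       : Pred (Fin n) 0ℓ
      T?        : Decidable T
      W?        : Decidable W
      T⊆W       : T ⊆ W
      W⊆A       : W ⊆ A
      inhabited : ∃ T
      closed    : ∀ {u v} → T u → A v → u ∼ v → W v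
      universal : ∀ {u v} → W u → ¬ T u → W v → u ≢ v → u ∼ v
      no-triple : ∀ {u v w} → W u → W v → W w → u ≢ v → u ≢ w → v ≢ w →
                  u ∼ v ⊎ u ∼ w ⊎ v ∼ w

  -- Colourings of the subgraph induced by A are total functions, compared only on A; v₀
  -- names the changed vertex of a step at which nothing changes on A.
  module Partial {ℓ : ℕ} (v₀ : Fin n) (A : Pred (Fin n) 0ℓ) where

    ProperOn : (Fin n → Fin ℓ) → Set
    ProperOn α = ∀ {u v} → A u → A v → u ∼ v → α u ≢ α v

    Step : (Fin n → Fin ℓ) → (Fin n → Fin ℓ) → Set
    Step α β = ProperOn α × ProperOn β × ∃ λ v → ∀ {u} → A u → u ≢ v → α u ≡ β u

    Reach : (Fin n → Fin ℓ) → (Fin n → Fin ℓ) → Set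
    Reach = Star Step

    Reach-sym : ∀ {α β} → Reach α β → Reach β α
    Reach-sym = reverse λ (p , q , v , same) → q , p , v , λ a u≢v → sym (same a u≢v)

    reach-≗ : ∀ {α β} → ProperOn α → ProperOn β → (∀ {u} → A u → α u ≡ β u) → Reach α β
    reach-≗ p q same = (p , q , v₀ , λ a _ → same a) ◅ ε

    -- A vertex that is not overwritten but already has colour c is not adjacent to
    -- an overwritten one, since both have colour c in β.
    overwrite-proper : ∀ {P : Pred (Fin n) 0ℓ} (P? : Decidable P) {α β} (c : Fin ℓ) →
      ProperOn α → ProperOn β → (∀ {u} → A u → β u ≡ α u ⊎ β u ≡ c) →
      ProperOn (overwrite P? α β)
    overwrite-proper P? {α} {β} c p q mono {u} {v} a b e with P? u | P? v
    ... | yes _ | yes _ = q a b e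
    ... | no _  | no _  = p a b e
    ... | yes _ | no _ with mono a | mono b
    ...   | inj₁ eq | _ = λ βu≡αv → p a b e (trans (sym eq) βu≡αv)
    ...   | inj₂ eq | inj₁ eq′ = λ βu≡αv → q a b e (trans βu≡αv (sym eq′))
    ...   | inj₂ eq | inj₂ eq′ = λ _ → q a b e (trans eq (sym eq′))
    overwrite-proper P? {α} {β} c p q mono {u} {v} a b e | no _  | yes _ with mono a | mono b
    ...   | _ | inj₁ eq = λ αu≡βv → p a b e (trans αu≡βv eq)
    ...   | inj₁ eq′ | inj₂ eq = λ αu≡βv → q a b e (trans eq′ αu≡βv)
    ...   | inj₂ eq′ | inj₂ eq = λ _ → q a b e (trans eq′ (sym eq))

    -- All changes are towards the one colour `c`, so `overwrite-proper` keeps every intermediate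
    -- colouring proper, and the vertices may be switched singly in any order.
    monochrome : ∀ {α β} (c : Fin ℓ) → ProperOn α → ProperOn β →
                 (∀ {u} → A u → β u ≡ α u ⊎ β u ≡ c) → Reach α β
    monochrome {α} {β} c p q mono = go (allFin n) p mono λ {u} _ _ → ∈-allFin u
      where
      go : ∀ vs {α} → ProperOn α → (∀ {u} → A u → β u ≡ α u ⊎ β u ≡ c) →
           (∀ {u} → A u → α u ≢ β u → u ∈ vs) → Reach α β
      go [] {α} p mono rest = reach-≗ p q λ {u} a →
        decidable-stable (α u ≟ β u) λ neq → case rest a neq of λ ()
      go (v ∷ vs) {α} p mono rest =
        (p , p′ , v , λ _ u≢v → sym (overwrite-out (_≟ v) α β u≢v)) ◅ go vs p′ mono′ rest′
        where
        p′ : ProperOn (overwrite (_≟ v) α β)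
        p′ = overwrite-proper (_≟ v) c p q mono
        mono′ : ∀ {u} → A u → β u ≡ overwrite (_≟ v) α β u ⊎ β u ≡ c
        mono′ {u} a with u ≟ v
        ... | yes _ = inj₁ refl
        ... | no _  = mono a
        rest′ : ∀ {u} → A u → overwrite (_≟ v) α β u ≢ β u → u ∈ vs
        rest′ {u} a neq with u ≟ v
        ... | yes _  = contradiction refl neq
        ... | no u≢v with rest a neq
        ...   | here u≡v = contradiction u≡v u≢v
        ...   | there u∈vs = u∈vs

    module _ {P : Pred (Fin n) 0ℓ} (P? : Decidable P) (α : Fin n → Fin ℓ) (c : Fin ℓ)
      (p : ProperOn α)
      (safe : ∀ {u v} → A u → A v → P u → u ∼ v → ¬ P v × α v ≢ c) where

      recolour : Fin n → Fin ℓ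
      recolour = overwrite P? α (const c)

      recolour-proper : ProperOn recolour
      recolour-proper {u} {v} a b e with P? u | P? v
      ... | yes pu | yes pv = contradiction pv (proj₁ (safe a b pu e))
      ... | yes pu | no _   = ≢-sym (proj₂ (safe a b pu e))
      ... | no _   | yes pv = proj₂ (safe b a pv (symm e))
      ... | no _   | no _   = p a b e

      recolour-reach : Reach α recolour
      recolour-reach = monochrome c p recolour-proper mono
        where
        mono : ∀ {u} → A u → recolour u ≡ α u ⊎ recolour u ≡ c
        mono {u} _ with P? u
        ... | yes _ = inj₂ refl
        ... | no _  = inj₁ refl

  -- Extending connectedness across a removable set.

  module Removal {k ℓ : ℕ} (v₀ : Fin n) {A : Pred (Fin n) 0ℓ} (A? : Decidable A) (R : Removable A)
    (γ : Fin n → Fin k) (γ-proper : Proper G γ) (k<ℓ : k ℕ.< ℓ) where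
    open Removable R

    Rest : Pred (Fin n) 0ℓ
    Rest u = A u × ¬ T u

    rest? : Decidable Rest
    rest? u = A? u ×-dec ¬? (T? u)

    open Partial {ℓ} v₀ A
    module Rest = Partial {ℓ} v₀ Rest

    γ-small : ∀ {u v w} → W u → W v → W w → u ≢ v → u ≢ w → v ≢ w → γ u ≡ γ v → γ u ≢ γ w
    γ-small Wu Wv Ww u≢v u≢w v≢w uv uw with no-triple Wu Wv Ww u≢v u≢w v≢w
    ... | inj₁ e        = γ-proper _ _ e uv
    ... | inj₂ (inj₁ e) = γ-proper _ _ e uw
    ... | inj₂ (inj₂ e) = γ-proper _ _ e (trans (sym uv) uw)

    -- A vertex of W outside T is adjacent to all the rest of W, so it shares its γ-class with no
    -- other vertex of W.
    twin-in-T : ∀ {u v} → W u → W v → u ≢ v → γ u ≡ γ v → T u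
    twin-in-T {u} {v} Wu Wv u≢v eq = decidable-stable (T? u) λ ¬Tu →
      γ-proper u v (universal Wu ¬Tu Wv u≢v) eq

    Normal : (Fin n → Fin ℓ) → Set
    Normal α = ∀ {u v} → T u → T v → γ u ≡ γ v → α u ≡ α v

    normal-W : ∀ {α} → Normal α → ∀ {u v} → W u → W v → γ u ≡ γ v → α u ≡ α v
    normal-W {α} N {u} {v} Wu Wv eq with u ≟ v
    ... | yes refl = refl
    ... | no u≢v = N (twin-in-T Wu Wv u≢v eq) (twin-in-T Wv Wu (≢-sym u≢v) (sym eq)) eq

    unused-normal : ∀ {α} → Normal α → ∃ λ c → ∀ {u} → W u → α u ≢ c
    unused-normal {α} N = Counting.unused W? γ α k<ℓ γ-small
      λ Wu (v , Wv , u≢v , eq) → v , Wv , u≢v , normal-W N Wu Wv eq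

    Split : (Fin n → Fin ℓ) → Fin n → Fin n → Set
    Split α u v = W u × W v × γ u ≡ γ v × α u ≢ α v

    split? : ∀ α u v → Dec (Split α u v)
    split? α u v = W? u ×-dec W? v ×-dec (γ u ≟ γ v) ×-dec ¬? (α u ≟ α v)

    Unhappy : (Fin n → Fin ℓ) → Pred (Fin n) 0ℓ
    Unhappy α u = ∃ (Split α u)

    unhappy? : ∀ α → Decidable (Unhappy α)
    unhappy? α u = any? (split? α u)

    Alone : (Fin n → Fin ℓ) → Pred (Fin n) 0ℓ
    Alone α u = ∀ v → ¬ Counting.Twin W? γ α k<ℓ γ-small α u v

    alone? : ∀ α → Decidable (Alone α)
    alone? α u = all? λ v → ¬? (Counting.twin? W? γ α k<ℓ γ-small α u v)

    Mend : (Fin n → Fin ℓ) → Set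
    Mend α = ∃₂ λ u v → Split α u v × ∃ λ c → ∀ {w} → W w → w ≢ u → w ≢ v → α w ≢ c

    -- If every vertex alone in its colour class of α is alone in its class of γ, then α
    -- uses at most as many colours on W as γ does, so some colour is free.
    normal-or-mend : ∀ α → Normal α ⊎ Mend α
    normal-or-mend α with any? (λ u → unhappy? α u ×-dec alone? α u)
    -- As `u` is alone, no other vertex of W has colour `α u`, so this colour can serve the partner
    -- `v` too.
    ... | yes (u , (v , split) , alone) = inj₂ (u , v , split , α u , λ {w} Ww w≢u _ eq →
            alone w (Ww , ≢-sym w≢u , sym eq))
    ... | no ¬found with any? (unhappy? α)
    ...   | no ¬unhappy = inj₁ λ {u} {v} Tu Tv eq → decidable-stable (α u ≟ α v) λ neq →
            ¬unhappy (u , v , T⊆W Tu , T⊆W Tv , eq , neq)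
    ...   | yes (u , v , split) with Counting.unused W? γ α k<ℓ γ-small twins
      where
      twins : ∀ {u} → W u → ∃ (Counting.Twin W? γ α k<ℓ γ-small γ u) →
              ∃ (Counting.Twin W? γ α k<ℓ γ-small α u)
      twins {u} Wu (v , Wv , u≢v , eq) with α u ≟ α v
      ... | yes same = v , Wv , u≢v , same
      ... | no neq with any? (Counting.twin? W? γ α k<ℓ γ-small α u)
      ...   | yes found = found
      ...   | no none = contradiction
              (u , (v , Wu , Wv , eq , neq) , λ w tw → none (w , tw)) ¬found
    ...     | c , free = inj₂ (u , v , split , c , λ Ww _ _ → free Ww)

    -- The pair is an entire γ-class of W, so giving both vertices `c` settles that class and
    -- touches no other. It is safe because their neighbours in A lie in W, where only the pair
    -- itself may carry `c`.
    mend : ∀ {α} → ProperOn α → Mend α →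
           ∃ λ β → ProperOn β × Reach α β × size (unhappy? β) ℕ.< size (unhappy? α)
    mend {α} p (u , v , (Wu , Wv , eq , neq) , c , free) =
      β , recolour-proper M? α c p safe , recolour-reach M? α c p safe ,
      size-strict (unhappy? β) (unhappy? α) shrink (v , Wu , Wv , eq , neq) λ u-unhappy →
        happy (inj₁ refl) u-unhappy
      where
      M : Pred (Fin n) 0ℓ
      M w = w ≡ u ⊎ w ≡ v
      M? : Decidable M
      M? w = (w ≟ u) ⊎-dec (w ≟ v)
      u≢v : u ≢ v
      u≢v = neq ∘ cong α
      M⊆T : M ⊆ T
      M⊆T (inj₁ refl) = twin-in-T Wu Wv u≢v eq
      M⊆T (inj₂ refl) = twin-in-T Wv Wu (≢-sym u≢v) (sym eq)
      M-γ : ∀ {w x} → M w → M x → γ w ≡ γ x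
      M-γ (inj₁ refl) (inj₁ refl) = refl
      M-γ (inj₁ refl) (inj₂ refl) = eq
      M-γ (inj₂ refl) (inj₁ refl) = sym eq
      M-γ (inj₂ refl) (inj₂ refl) = refl
      safe : ∀ {w x} → A w → A x → M w → w ∼ x → ¬ M x × α x ≢ c
      safe Aw Ax Mw e = ¬Mx , free (closed (M⊆T Mw) Ax e) (¬Mx ∘ inj₁) (¬Mx ∘ inj₂)
        where ¬Mx = λ Mx → γ-proper _ _ e (M-γ Mw Mx)
      β : Fin n → Fin ℓ
      β = recolour M? α c p safe
      class : ∀ {w x} → M w → W x → γ w ≡ γ x → M x
      class {w} {x} Mw Wx eq′ = decidable-stable (M? x) λ ¬Mx →
        γ-small Wu Wv Wx u≢v (¬Mx ∘ inj₁ ∘ sym) (¬Mx ∘ inj₂ ∘ sym) eq (trans (M-γ (inj₁ refl) Mw) eq′)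
      happy : ∀ {w} → M w → ¬ Unhappy β w
      happy Mw (x , Ww , Wx , eq′ , neq′) = neq′
        (trans (overwrite-in M? α _ Mw) (sym (overwrite-in M? α _ (class Mw Wx eq′))))
      shrink : Unhappy β ⊆ Unhappy α
      shrink {w} uh@(x , Ww , Wx , eq′ , neq′) = x , Ww , Wx , eq′ , λ same → neq′
        (trans (overwrite-out M? α _ ¬Mw) (trans same (sym (overwrite-out M? α _ ¬Mx))))
        where
        ¬Mw = λ Mw → happy Mw uh
        ¬Mx = λ Mx → ¬Mw (class Mx Ww (sym eq′))

    normalise : ∀ α → ProperOn α → ∃ λ β → ProperOn β × Reach α β × Normal β
    normalise α p = go α p (<-wellFounded _)
      where
      go : ∀ α → ProperOn α → Acc ℕ._<_ (size (unhappy? α)) →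
           ∃ λ β → ProperOn β × Reach α β × Normal β
      go α p (acc rs) with normal-or-mend α
      ... | inj₁ N = α , p , ε , N
      ... | inj₂ m with mend p m
      ...   | β , q , α↝β , smaller with go β q (rs smaller)
      ...     | δ , r , β↝δ , N = δ , r , α↝β ◅◅ β↝δ , N

    record Evacuated (α : Fin n → Fin ℓ) (b : Fin ℓ) : Set where
      field
        result  : Fin n → Fin ℓ
        proper  : ProperOn result
        reach   : Reach α result
        normal  : Normal result
        outside : ∀ {u} → ¬ T u → result u ≡ α u
        kept    : ∀ {u} → α u ≢ b → result u ≡ α u
        avoids  : ∀ {u} → T u → result u ≢ b

    evacuate : ∀ α b → ProperOn α → Normal α → Evacuated α b
    evacuate α b p N with unused-normal N
    ... | c , free = record
      { result  = recolour M? α c p safe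
      ; proper  = recolour-proper M? α c p safe
      ; reach   = recolour-reach M? α c p safe
      ; normal  = normal′
      ; outside = λ ¬Tu → overwrite-out M? α _ (¬Tu ∘ proj₁)
      ; kept    = λ neq → overwrite-out M? α _ (neq ∘ proj₂)
      ; avoids  = avoids′
      }
      where
      M : Pred (Fin n) 0ℓ
      M u = T u × α u ≡ b
      M? : Decidable M
      M? u = T? u ×-dec (α u ≟ b)
      safe : ∀ {w x} → A w → A x → M w → w ∼ x → ¬ M x × α x ≢ c
      safe Aw Ax (Tw , wb) e = (λ (_ , xb) → p Aw Ax e (trans wb (sym xb))) , free (closed Tw Ax e)
      normal′ : Normal (recolour M? α c p safe)
      normal′ Tu Tv eq = overwrite-cong M? α (const c)
        (λ (_ , ub) → Tv , trans (sym (N Tu Tv eq)) ub)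
        (λ (_ , vb) → Tu , trans (N Tu Tv eq) vb) (N Tu Tv eq) refl
      avoids′ : ∀ {u} → T u → recolour M? α c p safe u ≢ b
      avoids′ Tu = overwrite-avoids M? α (const c)
        (λ (_ , ub) c≡b → free (T⊆W Tu) (trans ub (sym c≡b))) (λ ¬M ub → ¬M (Tu , ub))

    record Lift (α β : Fin n → Fin ℓ) : Set where
      field
        result : Fin n → Fin ℓ
        proper : ProperOn result
        reach  : Reach α result
        normal : Normal result
        agrees : ∀ {u} → Rest u → result u ≡ β u

    -- Before `d` takes its new colour, T is cleared of that colour. Neighbours of `d` in T then
    -- cause no conflict, and those outside T have not moved, so properness of `δ` handles them.
    lift-step : ∀ {α β δ} → ProperOn α → Normal α → (∀ {u} → Rest u → α u ≡ β u) →
                Rest.Step β δ → Lift α δ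
    lift-step {α} {β} {δ} p N agree (_ , q , d , same) with rest? d
    ... | no ¬Rd = record
      { result = α ; proper = p ; reach = ε ; normal = N
      ; agrees = λ Ru → trans (agree Ru) (same Ru λ { refl → ¬Rd Ru })
      }
    ... | yes Rd@(Ad , ¬Td) = record
      { result = recolour (_≟ d) E.result (δ d) E.proper safe
      ; proper = recolour-proper (_≟ d) E.result (δ d) E.proper safe
      ; reach  = E.reach ◅◅ recolour-reach (_≟ d) E.result (δ d) E.proper safe
      ; normal = λ Tu Tv eq → trans (out Tu) (trans (E.normal Tu Tv eq) (sym (out Tv)))
      ; agrees = agrees′
      }
      where
      module E = Evacuated (evacuate α (δ d) p N)
      safe : ∀ {w x} → A w → A x → w ≡ d → w ∼ x → x ≢ d × E.result x ≢ δ d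
      safe {x = x} Aw Ax refl e = x≢d , avoid
        where
        x≢d : x ≢ d
        x≢d x≡d = irrefl (sym x≡d) e
        avoid : E.result x ≢ δ d
        avoid eq = case T? x of λ where
          (yes Tx) → E.avoids Tx eq
          (no ¬Tx) → q Rd (Ax , ¬Tx) e (sym (trans
            (sym (trans (E.outside ¬Tx) (trans (agree (Ax , ¬Tx)) (same (Ax , ¬Tx) x≢d)))) eq))
      out : ∀ {u} → T u → recolour (_≟ d) E.result (δ d) E.proper safe u ≡ E.result u
      out Tu = overwrite-out (_≟ d) E.result _ λ { refl → ¬Td Tu }
      agrees′ : ∀ {u} → Rest u → recolour (_≟ d) E.result (δ d) E.proper safe u ≡ δ u
      agrees′ {u} Ru with u ≟ d
      ... | yes refl = refl
      ... | no u≢d   = trans (E.outside (proj₂ Ru)) (trans (agree Ru) (same Ru u≢d))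

    lift : ∀ {α β δ} → ProperOn α → Normal α → (∀ {u} → Rest u → α u ≡ β u) →
           Rest.Reach β δ → Lift α δ
    lift {α} p N agree ε = record
      { result = α ; proper = p ; reach = ε ; normal = N ; agrees = agree }
    lift p N agree (s ◅ ss) = record
      { result = L₂.result ; proper = L₂.proper ; reach = L₁.reach ◅◅ L₂.reach
      ; normal = L₂.normal ; agrees = L₂.agrees }
      where
      module L₁ = Lift (lift-step p N agree s)
      module L₂ = Lift (lift L₁.proper L₁.normal L₁.agrees ss)

    -- One target colour `b` is treated at a time: T is cleared of `b`, then every vertex of T whose
    -- target is `b` receives it. Neighbours outside T already have their target colours and so
    -- avoid `b`.
    align : ∀ {α β} → ProperOn α → ProperOn β → Normal α → Normal β →
            (∀ {u} → Rest u → α u ≡ β u) → Reach α β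
    align {α} {β} p q Nα Nβ agree = go α p Nα agree (<-wellFounded _)
      where
      Wrong : (Fin n → Fin ℓ) → Pred (Fin n) 0ℓ
      Wrong α u = T u × α u ≢ β u
      wrong? : ∀ α → Decidable (Wrong α)
      wrong? α u = T? u ×-dec ¬? (α u ≟ β u)
      go : ∀ α → ProperOn α → Normal α → (∀ {u} → Rest u → α u ≡ β u) →
           Acc ℕ._<_ (size (wrong? α)) → Reach α β
      go α p N agree (acc rs) with any? (wrong? α)
      ... | no none = reach-≗ p q same
        where
        same : ∀ {u} → A u → α u ≡ β u
        same {u} Au with T? u
        ... | yes Tu = decidable-stable (α u ≟ β u) λ neq → none (u , Tu , neq)
        ... | no ¬Tu = agree (Au , ¬Tu)
      ... | yes (t , Tt , neq) = E.reach ◅◅ recolour-reach M? E.result b E.proper safe ◅◅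
              go α′ (recolour-proper M? E.result b E.proper safe) normal′ agree′
                 (rs (size-strict (wrong? α′) (wrong? α) shrink {t} (Tt , neq)
                       λ (_ , neq′) → neq′ (overwrite-in M? E.result (const b) (Tt , refl))))
        where
        b : Fin ℓ
        b = β t
        module E = Evacuated (evacuate α b p N)
        M : Pred (Fin n) 0ℓ
        M u = T u × β u ≡ b
        M? : Decidable M
        M? u = T? u ×-dec (β u ≟ b)
        safe : ∀ {w x} → A w → A x → M w → w ∼ x → ¬ M x × E.result x ≢ b
        safe {w} {x} Aw Ax (Tw , wb) e = (λ (_ , xb) → clash xb) , avoid
          where
          clash : β x ≢ b
          clash xb = q Aw Ax e (trans wb (sym xb))
          avoid : E.result x ≢ b
          avoid eq = case T? x of λ where
            (yes Tx) → E.avoids Tx eq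
            (no ¬Tx) → clash (trans (sym (trans (E.outside ¬Tx) (agree (Ax , ¬Tx)))) eq)
        α′ : Fin n → Fin ℓ
        α′ = recolour M? E.result b E.proper safe
        normal′ : Normal α′
        normal′ Tu Tv eq = overwrite-cong M? E.result (const b)
          (λ (_ , ub) → Tv , trans (sym (Nβ Tu Tv eq)) ub)
          (λ (_ , vb) → Tu , trans (Nβ Tu Tv eq) vb) (E.normal Tu Tv eq) refl
        agree′ : ∀ {u} → Rest u → α′ u ≡ β u
        agree′ (Au , ¬Tu) = trans (overwrite-out M? E.result _ (¬Tu ∘ proj₁))
          (trans (E.outside ¬Tu) (agree (Au , ¬Tu)))
        -- A vertex already correct with colour `b` leaves during the evacuation but gets `b` back;
        -- one correct with another colour never moves.
        shrink : Wrong α′ ⊆ Wrong α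
        shrink {u} (Tu , neq′) = Tu , λ αu≡βu → case β u ≟ b of λ where
          (yes ub) → neq′ (trans (overwrite-in M? E.result _ (Tu , ub)) (sym ub))
          (no ¬ub) → neq′ (trans (overwrite-out M? E.result _ (¬ub ∘ proj₂))
            (trans (E.kept (λ αub → ¬ub (trans (sym αu≡βu) αub))) αu≡βu))

    extend : (∀ α β → Rest.ProperOn α → Rest.ProperOn β → Rest.Reach α β) →
             ∀ α β → ProperOn α → ProperOn β → Reach α β
    extend connected α β p q with normalise α p | normalise β q
    ... | α₁ , p₁ , α↝α₁ , N | β₁ , q₁ , β↝β₁ , N′ =
      α↝α₁ ◅◅ L.reach ◅◅ align L.proper q₁ L.normal N′ L.agrees ◅◅ Reach-sym β↝β₁
      where
      restrict : ∀ {α} → ProperOn α → Rest.ProperOn α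
      restrict p (a , _) (b , _) = p a b
      module L = Lift (lift p₁ N (λ _ → refl)
        (connected α₁ β₁ (restrict {α₁} p₁) (restrict {β₁} q₁)))

-- Induced subgraphs from tables of edges and non-edges.

-- An equivalence with its converse in contrapositive form, so that non-edges transfer directly;
-- decidability recovers the converse.
Match : Set → Set → Set
Match X Y = (X → Y) × (¬ X → ¬ Y)

match-yes : ∀ {X Y} → X → Y → Match X Y
match-yes x y = const y , contradiction x

match-no : ∀ {X Y} → ¬ X → ¬ Y → Match X Y
match-no ¬x ¬y = (λ x → contradiction x ¬x) , const ¬y

Row : ∀ m → (Fin m → Set) → Set
Row ℕ.zero    Q = ⊤
Row (ℕ.suc m) Q = Q zero × Row m (Q ∘ suc)

Triangle : ∀ m → (Fin m → Fin m → Set) → Set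
Triangle ℕ.zero    R = ⊤
Triangle (ℕ.suc m) R = Row m (R zero ∘ suc) × Triangle m (λ i j → R (suc i) (suc j))

row : ∀ {m Q} → Row m Q → ∀ i → Q i
row (q , qs) zero    = q
row (q , qs) (suc i) = row qs i

triangle : ∀ {m R} → Triangle m R → ∀ i j → i < j → R i j
triangle (qs , t) zero    (suc j) _         = row qs j
triangle (qs , t) (suc i) (suc j) (s≤s i<j) = triangle t i j i<j

module _ {n} (G : Graph n) where
  open Graph G

  separates : ∀ {u v w} → u ∼ w → ¬ v ∼ w → u ≢ v
  separates uw ¬vw refl = ¬vw uw

  adjacent⇒≢ : ∀ {u v} → u ∼ v → u ≢ v
  adjacent⇒≢ uv u≡v = irrefl u≡v uv

  module _ {m} (H : Graph m) (f : Fin m → Fin n) where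
    module H = Graph H

    -- For a concrete `H` this computes to an edge or a non-edge of `G`, so an induced copy is given
    -- by a plain tuple of such facts for `i < j`.
    Entry : Fin m → Fin m → Set
    Entry i j = if does (i H.∼? j) then f i ∼ f j else ¬ f i ∼ f j

    entry⇒match : ∀ i j → Entry i j → Match (i H.∼ j) (f i ∼ f j)
    entry⇒match i j e with i H.∼? j
    ... | yes ij = match-yes ij e
    ... | no ¬ij = match-no ¬ij e

    triangle⇒match : Triangle m Entry → ∀ i j → Match (i H.∼ j) (f i ∼ f j)
    triangle⇒match t i j with <-cmp i j
    ... | tri< i<j _ _  = entry⇒match i j (triangle t i j i<j)
    ... | tri≈ _ refl _ = match-no (H.irrefl refl) (irrefl refl)
    ... | tri> _ _ j<i with entry⇒match j i (triangle t j i j<i)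
    ...   | to , from = symm ∘ to ∘ H.symm , λ ¬ij → from (¬ij ∘ H.symm) ∘ symm

    induced : Triangle m (λ i j → f i ≢ f j) → Triangle m Entry → InducedSubgraph H G
    induced d t = f , injective , λ i j → let (to , from) = triangle⇒match t i j in
      mk⇔ to λ e → decidable-stable (i H.∼? j) λ ¬ij → from ¬ij e
      where
      injective : ∀ {i j} → f i ≡ f j → i ≡ j
      injective {i} {j} eq with <-cmp i j
      ... | tri< i<j _ _ = contradiction eq (triangle d i j i<j)
      ... | tri≈ _ i≡j _ = i≡j
      ... | tri> _ _ j<i = contradiction (sym eq) (triangle d j i j<i)

  -- Pentagons and their twins.

  open Graph (C 5) using ()
    renaming (_∼_ to _≈₅_; _∼?_ to _≈₅?_; symm to ≈₅-sym; irrefl to ≈₅-irrefl)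

  Pentagon : (Fin 5 → Fin n) → Set
  Pentagon c = ∀ i j → Match (i ≈₅ j) (c i ∼ c j)

  -- Adjacency to `c p` itself is left open, so `c p` counts as its own twin.
  TwinAt : (Fin 5 → Fin n) → Fin 5 → Fin n → Set
  TwinAt c p x = ∀ j → j ≢ p → Match (p ≈₅ j) (x ∼ c j)

  replace : (Fin 5 → Fin n) → Fin 5 → Fin n → Fin 5 → Fin n
  replace c p x = overwrite (_≟ p) c (const x)

  replace-at : ∀ c p x → replace c p x p ≡ x
  replace-at c p x = overwrite-in (_≟ p) c (const x) refl

  replace-off : ∀ c p x {j} → j ≢ p → replace c p x j ≡ c j
  replace-off c p x = overwrite-out (_≟ p) c (const x)

  -- Lets statements about vertices seen from `c` be applied to the pentagon through a chosen twin.
  replace-pentagon : ∀ {c p x} → Pentagon c → TwinAt c p x → Pentagon (replace c p x)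
  replace-pentagon {p = p} pent tw i j with i ≟ p | j ≟ p
  ... | yes refl | yes refl = match-no (≈₅-irrefl refl) (irrefl refl)
  ... | yes refl | no j≢p   = tw j j≢p
  ... | no i≢p   | yes refl = symm ∘ proj₁ (tw i i≢p) ∘ ≈₅-sym {i} ,
                              λ ¬ip → proj₂ (tw i i≢p) (¬ip ∘ ≈₅-sym {j} {i}) ∘ symm
  ... | no _     | no _     = pent i j

  next : Fin 5 → Fin 5
  next 0F = 1F
  next 1F = 2F
  next 2F = 3F
  next 3F = 4F
  next 4F = 0F

  next² next³ next⁴ : Fin 5 → Fin 5
  next² = next ∘ next
  next³ = next ∘ next²
  next⁴ = next ∘ next³

  Near : Fin 5 → Fin 5 → Set
  Near p q = q ≡ p ⊎ q ≡ next p ⊎ p ≡ next q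

  near? : ∀ p q → Dec (Near p q)
  near? p q = (q ≟ p) ⊎-dec (q ≟ next p) ⊎-dec (p ≟ next q)

  abstract

    orbit : ∀ i j → j ≡ i ⊎ j ≡ next i ⊎ j ≡ next² i ⊎ j ≡ next³ i ⊎ j ≡ next⁴ i
    orbit = from-yes (all? λ i → all? λ j → (j ≟ i) ⊎-dec (j ≟ next i) ⊎-dec (j ≟ next² i)
      ⊎-dec (j ≟ next³ i) ⊎-dec (j ≟ next⁴ i))

    sides : ∀ i → i ≈₅ next i × i ≈₅ next⁴ i × ¬ i ≈₅ next² i × ¬ i ≈₅ next³ i
    sides = from-yes (all? λ i → (i ≈₅? next i) ×-dec (i ≈₅? next⁴ i) ×-dec
      ¬? (i ≈₅? next² i) ×-dec ¬? (i ≈₅? next³ i))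

    next-distinct : ∀ i → next i ≢ i × next² i ≢ i × next³ i ≢ i × next⁴ i ≢ i
    next-distinct = from-yes (all? λ i → ¬? (next i ≟ i) ×-dec ¬? (next² i ≟ i) ×-dec
      ¬? (next³ i ≟ i) ×-dec ¬? (next⁴ i ≟ i))

    next⁵ : ∀ i → next (next⁴ i) ≡ i
    next⁵ = from-yes (all? λ i → next (next⁴ i) ≟ i)

    neighbour-off : ∀ p q → ∃ λ j → q ≈₅ j × j ≢ p
    neighbour-off = from-yes (all? λ p → all? λ q → any? λ j → (q ≈₅? j) ×-dec ¬? (j ≟ p))

    non-neighbour-off : ∀ p q → ∃ λ j → ¬ q ≈₅ j × j ≢ q × j ≢ p
    non-neighbour-off = from-yes (all? λ p → all? λ q → any? λ j →
      ¬? (q ≈₅? j) ×-dec ¬? (j ≟ q) ×-dec ¬? (j ≟ p))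

    -- The five-cycle has independence number two; its blow-up inherits this bound.
    two-near : ∀ p q r → Near p q ⊎ Near p r ⊎ Near q r
    two-near = from-yes (all? λ p → all? λ q → all? λ r → near? p q ⊎-dec near? p r ⊎-dec near? q r)

  module _ {c} (pent : Pentagon c) where

    pentagon-facts : ∀ i → c i ∼ c (next i) × c i ∼ c (next⁴ i) ×
                           ¬ c i ∼ c (next² i) × ¬ c i ∼ c (next³ i)
    pentagon-facts i = let (s₁ , s₄ , d₂ , d₃) = sides i in
      proj₁ (pent i _) s₁ , proj₁ (pent i _) s₄ , proj₂ (pent i _) d₂ , proj₂ (pent i _) d₃

    twin-facts : ∀ {p x} → TwinAt c p x → x ∼ c (next p) × x ∼ c (next⁴ p) ×
                                          ¬ x ∼ c (next² p) × ¬ x ∼ c (next³ p)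
    twin-facts {p} tw = let (s₁ , s₄ , d₂ , d₃) = sides p ; (n₁ , n₂ , n₃ , n₄) = next-distinct p in
      proj₁ (tw _ n₁) s₁ , proj₁ (tw _ n₄) s₄ , proj₂ (tw _ n₂) d₂ , proj₂ (tw _ n₃) d₃

    self-twin : ∀ p → TwinAt c p (c p)
    self-twin p j _ = pent p j

  module Structure (free : Free (P 5) (C 4) G) where

    no-path : ∀ {a b c d e} → a ∼ b → b ∼ c → c ∼ d → d ∼ e →
      ¬ a ∼ c → ¬ a ∼ d → ¬ a ∼ e → ¬ b ∼ d → ¬ b ∼ e → ¬ c ∼ e → ⊥
    no-path {a} {b} {c} {d} {e} ab bc cd de ¬ac ¬ad ¬ae ¬bd ¬be ¬ce = proj₁ free
      (induced (P 5) (lookup (a ∷ b ∷ c ∷ d ∷ e ∷ []))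
        ( (adjacent⇒≢ ab , ≢-sym (separates cd ¬ad) , ≢-sym (separates de ¬ae)
                         , ≢-sym (separates (symm de) ¬ad) , tt)
        , (adjacent⇒≢ bc , ≢-sym (separates de ¬be) , ≢-sym (separates (symm de) ¬bd) , tt)
        , (adjacent⇒≢ cd , separates (symm bc) (¬be ∘ symm) , tt)
        , (adjacent⇒≢ de , tt) , tt , tt)
        ((ab , ¬ac , ¬ad , ¬ae , tt) , (bc , ¬bd , ¬be , tt) , (cd , ¬ce , tt) , (de , tt) , tt , tt))

    -- Opposite corners have the same neighbours among the four vertices, so unlike in `no-path`
    -- their distinctness cannot be read off from the adjacencies.
    no-square : ∀ {a b c d} → a ∼ b → b ∼ c → c ∼ d → d ∼ a → a ≢ c → b ≢ d →
      ¬ a ∼ c → ¬ b ∼ d → ⊥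
    no-square {a} {b} {c} {d} ab bc cd da a≢c b≢d ¬ac ¬bd = proj₂ free
      (induced (C 4) (lookup (a ∷ b ∷ c ∷ d ∷ []))
        ( (adjacent⇒≢ ab , a≢c , ≢-sym (adjacent⇒≢ da) , tt) , (adjacent⇒≢ bc , b≢d , tt)
        , (adjacent⇒≢ cd , tt) , tt , tt)
        ((ab , ¬ac , symm da , tt) , (bc , ¬bd , tt) , (cd , tt) , tt , tt))

    module _ {c} (pent : Pentagon c) where

      -- Call the pentagon a, b, c, d, e from `c i` on. An edge xc closes the square x a b c unless
      -- x is b. Without it, the path x a b c d forces the edge xd, and then the square x a e d
      -- forces xe unless x is e. Thus x is b or a twin of e.
      twin-from-gap : ∀ {i x} → x ∼ c i → ¬ x ∼ c (next i) → ∃ λ p → TwinAt c p x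
      twin-from-gap {i} {x} xa ¬xb with x ≟ c (next i)
      ... | yes refl = next i , self-twin pent (next i)
      ... | no x≢b with x ∼? c (next² i)
      ...   | yes xc = ⊥-elim (no-square xa ab bc (symm xc) x≢b
                (separates ae ¬ce) ¬xb ¬ac)
        where
        ab = proj₁ (pentagon-facts pent i)
        bc = proj₁ (pentagon-facts pent (next i))
        ae = proj₁ (proj₂ (pentagon-facts pent i))
        ¬ac = proj₁ (proj₂ (proj₂ (pentagon-facts pent i)))
        ¬ce = proj₁ (proj₂ (proj₂ (pentagon-facts pent (next² i))))
      ...   | no ¬xc with x ∼? c (next³ i) | pentagon-facts pent i | pentagon-facts pent (next i)
                        | pentagon-facts pent (next² i) | pentagon-facts pent (next³ i)
      ...     | no ¬xd | ab , _ , ¬ac , ¬ad | bc , _ , ¬bd , _ | cd , _ | _ =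
                  ⊥-elim (no-path xa ab bc cd ¬xb ¬xc ¬xd ¬ac ¬ad ¬bd)
      ...     | yes xd | ab , ae , ¬ac , ¬ad | bc , _ , ¬bd , _ | _ | de , _ with x ≟ c (next⁴ i)
      ...       | yes refl = next⁴ i , self-twin pent (next⁴ i)
      ...       | no x≢e with x ∼? c (next⁴ i)
      ...         | no ¬xe = ⊥-elim (no-square xa ae (symm de) (symm xd) x≢e
                      (separates ab (¬bd ∘ symm)) ¬xe ¬ad)
      ...         | yes xe = next⁴ i , twin
        where
        s = sides (next⁴ i)
        twin : TwinAt c (next⁴ i) x
        twin j j≢p with orbit i j
        ... | inj₁ refl = match-yes (≈₅-sym {i} (proj₁ (proj₂ (sides i)))) xa
        ... | inj₂ (inj₁ refl) = match-no (subst (λ j → ¬ next⁴ i ≈₅ next j) (next⁵ i)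
                (proj₁ (proj₂ (proj₂ s)))) ¬xb
        ... | inj₂ (inj₂ (inj₁ refl)) = match-no
                (proj₁ (proj₂ (proj₂ (sides (next² i)))) ∘ ≈₅-sym {next⁴ i}) ¬xc
        ... | inj₂ (inj₂ (inj₂ (inj₁ refl))) =
                match-yes (≈₅-sym {next³ i} (proj₁ (sides (next³ i)))) xd
        ... | inj₂ (inj₂ (inj₂ (inj₂ refl))) = contradiction refl j≢p

      complete-or-twin : ∀ {i x} → x ∼ c i → (∀ j → x ∼ c j) ⊎ ∃ λ p → TwinAt c p x
      complete-or-twin {i} {x} e₀ with x ∼? c (next i)
      ... | no ¬e = inj₂ (twin-from-gap e₀ ¬e)
      ... | yes e₁ with x ∼? c (next² i)
      ...   | no ¬e = inj₂ (twin-from-gap e₁ ¬e)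
      ...   | yes e₂ with x ∼? c (next³ i)
      ...     | no ¬e = inj₂ (twin-from-gap e₂ ¬e)
      ...     | yes e₃ with x ∼? c (next⁴ i)
      ...       | no ¬e = inj₂ (twin-from-gap e₃ ¬e)
      ...       | yes e₄ = inj₁ λ j → case orbit i j of λ where
                    (inj₁ refl)                      → e₀
                    (inj₂ (inj₁ refl))               → e₁
                    (inj₂ (inj₂ (inj₁ refl)))        → e₂
                    (inj₂ (inj₂ (inj₂ (inj₁ refl)))) → e₃
                    (inj₂ (inj₂ (inj₂ (inj₂ refl)))) → e₄

      -- Otherwise the long way round the pentagon from `y` to `x` is an induced P₅.
      consecutive-adjacent : ∀ {p x y} → TwinAt c p x → TwinAt c (next p) y → x ∼ y
      consecutive-adjacent {p} {x} {y} tx ty with x ∼? y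
      ... | yes xy = xy
      ... | no ¬xy with twin-facts pent tx | twin-facts pent ty
                      | pentagon-facts pent (next² p) | pentagon-facts pent (next³ p)
      ...   | _ , xe , ¬xc , ¬xd | yc , _ , ¬yd , ¬ye | cd , _ , ¬ce , _ | de , _ =
              ⊥-elim (no-path yc cd de (symm xe) ¬yd ¬ye (¬xy ∘ symm) ¬ce (¬xc ∘ symm) (¬xd ∘ symm))

      -- For equal positions, two non-adjacent twins would form a square with the two pentagon
      -- neighbours of that position.
      near-adjacent : ∀ {p q x y} → TwinAt c p x → TwinAt c q y → x ≢ y → Near p q → x ∼ y
      near-adjacent {p} {_} {x} {y} tx ty x≢y (inj₁ refl) with x ∼? y
      ... | yes xy = xy
      ... | no ¬xy with twin-facts pent tx | twin-facts pent ty
                      | pentagon-facts pent (next p) | pentagon-facts pent (next⁴ p)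
      ...   | xb , xe , _ | yb , ye , _ | bc , _ , _ , ¬be | _ , _ , _ , ¬ec =
              ⊥-elim (no-square xb (symm yb) ye (symm xe) x≢y
                (separates bc (¬ec ∘ subst (λ j → c (next⁴ p) ∼ c j) (sym (cong next² (next⁵ p))))) ¬xy ¬be)
      near-adjacent tx ty _ (inj₂ (inj₁ refl)) = consecutive-adjacent tx ty
      near-adjacent tx ty _ (inj₂ (inj₂ refl)) = symm (consecutive-adjacent ty tx)

    -- The vertices meeting the pentagon in some but not all of its vertices form a clique
    -- blow-up T of it, and the vertices complete to the pentagon form a clique W ∖ T
    -- complete to T.
    module _ {A : Pred (Fin n) 0ℓ} (A? : Decidable A)
      {c} (pent : Pentagon c) (c∈A : ∀ i → A (c i)) where

      Attached Mixed : Pred (Fin n) 0ℓ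
      Attached x = A x × ∃ λ i → x ∼ c i
      Mixed x = Attached x × ∃ λ i → ¬ x ∼ c i

      attached? : Decidable Attached
      attached? x = A? x ×-dec any? λ i → x ∼? c i

      mixed? : Decidable Mixed
      mixed? x = attached? x ×-dec any? λ i → ¬? (x ∼? c i)

      mixed-twin : ∀ {x} → Mixed x → ∃ λ p → TwinAt c p x
      mixed-twin ((_ , i , xi) , j , ¬xj) with complete-or-twin pent xi
      ... | inj₁ complete = contradiction (complete j) ¬xj
      ... | inj₂ twin     = twin

      unmixed-complete : ∀ {x} → Attached x → ¬ Mixed x → ∀ i → x ∼ c i
      unmixed-complete {x} Wx ¬Tx i = decidable-stable (x ∼? c i) λ ¬xi → ¬Tx (Wx , i , ¬xi)

      -- Put `x` into the pentagon in place of `c p`. Then `y` is complete to the new pentagon or a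
      -- twin in it, and in both cases is adjacent to one of the four original vertices that remain.
      mixed-closed : ∀ {x y} → Mixed x → A y → x ∼ y → Attached y
      mixed-closed {x} {y} Tx Ay xy with mixed-twin Tx
      ... | p , tx with complete-or-twin (replace-pentagon pent tx)
                          (subst (y ∼_) (sym (replace-at c p x)) (symm xy))
      ...   | inj₁ complete = let (n₁ , _) = next-distinct p in
              Ay , next p , subst (y ∼_) (replace-off c p x n₁) (complete (next p))
      ...   | inj₂ (q , ty) = let (j , qj , j≢p) = neighbour-off p q in
              Ay , j , subst (y ∼_) (replace-off c p x j≢p)
                (proj₁ (ty j λ j≡q → ≈₅-irrefl (sym j≡q) qj) qj)

      -- Two non-adjacent complete vertices form a square with `c 0F` and `c 2F`. If `w` is mixed,
      -- put it into the pentagon: a twin there would miss one of the remaining original vertices,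
      -- so `d` is complete to the new pentagon, hence adjacent to `w`.
      complete-universal : ∀ {d w} → Attached d → ¬ Mixed d → Attached w → d ≢ w → d ∼ w
      complete-universal {d} {w} Wd ¬Td Ww d≢w with mixed? w
      ... | no ¬Tw with d ∼? w
      ...   | yes dw = dw
      ...   | no ¬dw = ⊥-elim (no-square (dc 0F) (symm (wc 0F)) (wc 2F) (symm (dc 2F)) d≢w
                (separates {w = c 4F} (proj₁ (pent 0F 4F) (proj₁ (proj₂ (sides 0F))))
                  (proj₂ (pent 2F 4F) (proj₁ (proj₂ (proj₂ (sides 2F))))))
                ¬dw (proj₂ (pent 0F 2F) (proj₁ (proj₂ (proj₂ (sides 0F))))))
        where
        dc = unmixed-complete Wd ¬Td
        wc = unmixed-complete Ww ¬Tw
      complete-universal {d} {w} Wd ¬Td Ww d≢w | yes Tw with mixed-twin Tw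
      ... | p , tw with complete-or-twin (replace-pentagon pent tw) {i = next p}
                          (subst (d ∼_) (sym (replace-off c p w (proj₁ (next-distinct p))))
                            (unmixed-complete Wd ¬Td (next p)))
      ...   | inj₁ complete = subst (d ∼_) (replace-at c p w) (complete p)
      ...   | inj₂ (q , td) = let (j , ¬qj , j≢q , j≢p) = non-neighbour-off p q in
              contradiction (subst (d ∼_) (sym (replace-off c p w j≢p)) (unmixed-complete Wd ¬Td j))
                (proj₂ (td j j≢q) ¬qj)

      attached-no-triple : ∀ {u v w} → Attached u → Attached v → Attached w →
        u ≢ v → u ≢ w → v ≢ w → u ∼ v ⊎ u ∼ w ⊎ v ∼ w
      attached-no-triple {u} {v} {w} Wu Wv Ww u≢v u≢w v≢w with mixed? u | mixed? v | mixed? w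
      ... | no ¬Tu | _      | _      = inj₁ (complete-universal Wu ¬Tu Wv u≢v)
      ... | _      | no ¬Tv | _      = inj₂ (inj₂ (complete-universal Wv ¬Tv Ww v≢w))
      ... | _      | _      | no ¬Tw = inj₂ (inj₁ (symm (complete-universal Ww ¬Tw Wu (≢-sym u≢w))))
      ... | yes Tu | yes Tv | yes Tw with mixed-twin Tu | mixed-twin Tv | mixed-twin Tw
      ...   | p , tu | q , tv | r , tw with two-near p q r
      ...     | inj₁ pq        = inj₁ (near-adjacent pent tu tv u≢v pq)
      ...     | inj₂ (inj₁ pr) = inj₂ (inj₁ (near-adjacent pent tu tw u≢w pr))
      ...     | inj₂ (inj₂ qr) = inj₂ (inj₂ (near-adjacent pent tv tw v≢w qr))

      pentagon-removable : Removable G A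
      pentagon-removable = record
        { T? = mixed? ; W? = attached? ; T⊆W = proj₁ ; W⊆A = proj₁
        ; inhabited = c 0F , (c∈A 0F , 1F , proj₁ (pent 0F 1F) (proj₁ (sides 0F))) , 0F , irrefl refl
        ; closed = mixed-closed ; universal = complete-universal ; no-triple = attached-no-triple }

    -- Finding a simplicial vertex or a pentagon.

    Simplicial : Pred (Fin n) 0ℓ → Pred (Fin n) 0ℓ
    Simplicial A v = A v × (∀ {x y} → A x → A y → v ∼ x → v ∼ y → x ≢ y → x ∼ y)

    simplicial-removable : ∀ {A v} → Decidable A → Simplicial A v → Removable G A
    simplicial-removable {A} {v} A? (Av , clique) = record
      { T = _≡ v ; W = W ; T? = _≟ v ; W? = λ x → A? x ×-dec ((x ≟ v) ⊎-dec (v ∼? x))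
      ; T⊆W = λ { refl → Av , inj₁ refl } ; W⊆A = proj₁ ; inhabited = v , refl
      ; closed = λ { refl Ax vx → Ax , inj₂ vx }
      ; universal = λ Wx _ Wy → W-clique Wx Wy
      ; no-triple = λ Wx Wy _ x≢y _ _ → inj₁ (W-clique Wx Wy x≢y) }
      where
      W : Pred (Fin n) 0ℓ
      W x = A x × (x ≡ v ⊎ v ∼ x)
      W-clique : ∀ {x y} → W x → W y → x ≢ y → x ∼ y
      W-clique (_ , inj₁ refl) (_ , inj₁ refl) x≢y = contradiction refl x≢y
      W-clique (_ , inj₁ refl) (_ , inj₂ vy) _ = vy
      W-clique (_ , inj₂ vx) (_ , inj₁ refl) _ = symm vx
      W-clique (Ax , inj₂ vx) (Ay , inj₂ vy) x≢y = clique Ax Ay vx vy x≢y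

    Meets : Pred (Fin n) 0ℓ → Pred (Fin n) 0ℓ
    Meets K a = ∃ λ x → K x × a ∼ x

    meets? : ∀ {K} → Decidable K → Decidable (Meets K)
    meets? K? a = any? λ x → K? x ×-dec (a ∼? x)

    -- For non-adjacent ends: an induced path with one or two inner vertices, all in `K`. Three or
    -- more inner vertices would already give an induced P₅.
    Joined : Pred (Fin n) 0ℓ → Fin n → Fin n → Set
    Joined K a b = (∃ λ x → K x × a ∼ x × b ∼ x) ⊎
      (∃₂ λ x y → K x × K y × a ∼ x × x ∼ y × y ∼ b × ¬ a ∼ y × ¬ x ∼ b)

    joined-sym : ∀ {K a b} → Joined K a b → Joined K b a
    joined-sym (inj₁ (x , Kx , ax , bx)) = inj₁ (x , Kx , bx , ax)
    joined-sym (inj₂ (x , y , Kx , Ky , ax , xy , yb , ¬ay , ¬xb)) =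
      inj₂ (y , x , Ky , Kx , symm yb , symm xy , symm ax , ¬xb ∘ symm , ¬ay ∘ symm)

    joined-mono : ∀ {K L a b} → K ⊆ L → Joined K a b → Joined L a b
    joined-mono K⊆L (inj₁ (x , Kx , r)) = inj₁ (x , K⊆L Kx , r)
    joined-mono K⊆L (inj₂ (x , y , Kx , Ky , r)) = inj₂ (x , y , K⊆L Kx , K⊆L Ky , r)

    -- What connectedness of K amounts to in a P₅-free graph.
    Linked : Pred (Fin n) 0ℓ → Set
    Linked K = ∀ {a b} → ¬ K a → ¬ K b → a ≢ b → ¬ a ∼ b → Meets K a → Meets K b → Joined K a b

    infixl 5 _▷_
    _▷_ : Pred (Fin n) 0ℓ → Fin n → Pred (Fin n) 0ℓ
    (K ▷ s) x = x ≡ s ⊎ K x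

    linked-singleton : ∀ s → Linked (_≡ s)
    linked-singleton s _ _ _ _ (_ , refl , as) (_ , refl , bs) = inj₁ (s , refl , as , bs)

    module _ {K s} (linked : Linked K) (¬Ks : ¬ K s) (s-meets : Meets K s) where

      -- Here `a` reaches the enlarged set only through `s`. If `b` misses `s`, then `s` and `b` are
      -- joined through `K`; prefixing `a` gives a join with two inner vertices, or an induced P₅ if
      -- there were two already.
      through : ∀ {a b} → ¬ Meets K a → ¬ (K ▷ s) b → ¬ a ∼ b → Meets (K ▷ s) a → Meets (K ▷ s) b →
                Joined (K ▷ s) a b
      through ¬ma ¬b ¬ab (x , inj₂ Kx , ax) mb = contradiction (x , Kx , ax) ¬ma
      through {a} {b} ¬ma ¬b ¬ab (_ , inj₁ refl , as) (x , x∈ , bx) with b ∼? s | x∈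
      ... | yes bs | _ = inj₁ (s , inj₁ refl , as , bs)
      ... | no ¬bs | inj₁ refl = contradiction bx ¬bs
      ... | no ¬bs | inj₂ Kx
        with linked ¬Ks (¬b ∘ inj₂) (λ { refl → ¬ab as }) (¬bs ∘ symm) s-meets (x , Kx , bx)
      ...   | inj₁ (y , Ky , sy , by) = inj₂ (s , y , inj₁ refl , inj₂ Ky , as , sy , symm by ,
                (λ ay → ¬ma (y , Ky , ay)) , ¬bs ∘ symm)
      ...   | inj₂ (y , z , Ky , Kz , sy , yz , zb , ¬sz , ¬yb) = ⊥-elim
                (no-path as sy yz zb (λ ay → ¬ma (y , Ky , ay)) (λ az → ¬ma (z , Kz , az))
                  ¬ab ¬sz (¬bs ∘ symm) ¬yb)

    linked-▷ : ∀ {K s} → Decidable K → Linked K → ¬ K s → Meets K s → Linked (K ▷ s)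
    linked-▷ {K} {s} K? linked ¬Ks s-meets {a} {b} ¬a ¬b a≢b ¬ab a-meets b-meets
      with meets? K? a | meets? K? b
    ... | yes ma | yes mb = joined-mono inj₂ (linked (¬a ∘ inj₂) (¬b ∘ inj₂) a≢b ¬ab ma mb)
    ... | no ¬ma | _      = through linked ¬Ks s-meets ¬ma ¬b ¬ab a-meets b-meets
    ... | yes _  | no ¬mb = joined-sym (through linked ¬Ks s-meets ¬mb ¬a (¬ab ∘ symm) b-meets a-meets)

    PentagonIn : Pred (Fin n) 0ℓ → Set
    PentagonIn A = ∃ λ c → Pentagon c × (∀ i → A (c i))

    Found : Pred (Fin n) 0ℓ → Set
    Found A = ∃ (Simplicial A) ⊎ PentagonIn A

    record Side (A : Pred (Fin n) 0ℓ) (v : Fin n) (K : Pred (Fin n) 0ℓ) : Set where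
      field
        v∈A       : A v
        K?        : Decidable K
        K⊆A       : K ⊆ A
        inhabited : ∃ K
        v∉K       : ¬ K v
        apart     : ¬ Meets K v
        linked    : Linked K

    module _ {A : Pred (Fin n) 0ℓ} (A? : Decidable A)
      (smaller : ∀ {B} (B? : Decidable B) → size B? ℕ.< size A? → ∃ B → Found B) where

      module _ {v K} (side : Side A v K) where
        open Side side

        Boundary Far : Pred (Fin n) 0ℓ
        Boundary s = A s × ¬ K s × Meets K s
        Far w = A w × ¬ K w × ¬ Meets K w

        boundary? : Decidable Boundary
        boundary? s = A? s ×-dec ¬? (K? s) ×-dec meets? K? s

        far? : Decidable Far
        far? w = A? w ×-dec ¬? (K? w) ×-dec ¬? (meets? K? w)

        classify : ∀ {x} → A x → K x ⊎ Boundary x ⊎ Far x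
        classify {x} Ax with K? x | meets? K? x
        ... | yes Kx | _     = inj₁ Kx
        ... | no ¬Kx | yes m = inj₂ (inj₁ (Ax , ¬Kx , m))
        ... | no ¬Kx | no ¬m = inj₂ (inj₂ (Ax , ¬Kx , ¬m))

        -- The base point moves to `w` because `v` may be adjacent to `s`, whereas `w` is adjacent
        -- to nothing in the enlarged set.
        enlarge : ∀ {w s} → Far w → Boundary s → ¬ w ∼ s → Side A w (K ▷ s)
        enlarge {w} {s} (Aw , ¬Kw , ¬mw) (As , ¬Ks , ms) ¬ws = record
          { v∈A = Aw
          ; K? = λ x → (x ≟ s) ⊎-dec K? x
          ; K⊆A = λ { (inj₁ refl) → As ; (inj₂ Kx) → K⊆A Kx }
          ; inhabited = s , inj₁ refl
          ; v∉K = λ { (inj₁ refl) → ¬mw ms ; (inj₂ Kw) → ¬Kw Kw }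
          ; apart = λ { (_ , inj₁ refl , ws) → ¬ws ws ; (x , inj₂ Kx , wx) → ¬mw (x , Kx , wx) }
          ; linked = linked-▷ K? linked ¬Ks ms
          }

        -- The boundary is a clique or closes a pentagon through v and K. In the former case a
        -- simplicial vertex of the far part remains simplicial in A.
        conclude : (∀ {w s} → Far w → Boundary s → w ∼ s) → Found A
        conclude full with any? (λ a → any? λ b →
            boundary? a ×-dec boundary? b ×-dec ¬? (a ≟ b) ×-dec ¬? (a ∼? b))
        ... | yes (a , b , Sa@(Aa , ¬Ka , ma) , Sb@(Ab , ¬Kb , mb) , a≢b , ¬ab)
          with linked ¬Ka ¬Kb a≢b ¬ab ma mb
        ...   | inj₁ (x , Kx , ax , bx) = ⊥-elim
                (no-square (full Fv Sa) ax (symm bx) (symm (full Fv Sb)) (λ { refl → v∉K Kx }) a≢b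
                  (λ vx → apart (x , Kx , vx)) ¬ab)
          where Fv = v∈A , v∉K , apart
        ...   | inj₂ (x , y , Kx , Ky , ax , xy , yb , ¬ay , ¬xb) =
                inj₂ (c , triangle⇒match (C 5) c
                  ( (full Fv Sa , (λ vx → apart (x , Kx , vx)) , (λ vy → apart (y , Ky , vy))
                                , full Fv Sb , tt)
                  , (ax , ¬ay , ¬ab , tt) , (xy , ¬xb , tt) , (yb , tt) , tt , tt)
                , row (v∈A , Aa , K⊆A Kx , K⊆A Ky , Ab , tt))
          where
          Fv = v∈A , v∉K , apart
          c = lookup (v ∷ a ∷ x ∷ y ∷ b ∷ [])
        conclude full | no clique with smaller far? far<A (v , v∈A , v∉K , apart)
          where
          far<A : size far? ℕ.< size A?
          far<A = size-strict far? A? proj₁ (K⊆A (proj₂ inhabited)) λ (_ , ¬K , _) →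
            ¬K (proj₂ inhabited)
        ... | inj₂ (c , pent , in-far) = inj₂ (c , pent , proj₁ ∘ in-far)
        ... | inj₁ (z , Fz@(Az , _ , ¬mz) , simplicial) = inj₁ (z , Az , simplicial′)
          where
          simplicial′ : ∀ {x y} → A x → A y → z ∼ x → z ∼ y → x ≢ y → x ∼ y
          -- A far vertex has no neighbour in `K`, so its neighbours in `A` are far or on the
          -- boundary; boundary pairs are adjacent by the clique property, mixed pairs by `full`.
          simplicial′ {x} {y} Ax Ay zx zy x≢y with classify Ax | classify Ay
          ... | inj₁ Kx | _ = contradiction (x , Kx , zx) ¬mz
          ... | _ | inj₁ Ky = contradiction (y , Ky , zy) ¬mz
          ... | inj₂ (inj₁ Sx) | inj₂ (inj₂ Fy) = symm (full Fy Sx)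
          ... | inj₂ (inj₂ Fx) | inj₂ (inj₁ Sy) = full Fx Sy
          ... | inj₂ (inj₂ Fx) | inj₂ (inj₂ Fy) = simplicial Fx Fy zx zy x≢y
          ... | inj₂ (inj₁ Sx) | inj₂ (inj₁ Sy) = decidable-stable (x ∼? y) λ ¬xy →
                  clique (x , y , Sx , Sy , x≢y , ¬xy)

      grow : ∀ {v K} (side : Side A v K) → Acc ℕ._<_ (size (¬? ∘ Side.K? side)) → Found A
      grow {v} {K} side (acc rs) with any? (λ w → any? λ s →
          far? side w ×-dec boundary? side s ×-dec ¬? (w ∼? s))
      ... | yes (w , s , Fw , Ss , ¬ws) = grow bigger
              (rs (size-strict (¬? ∘ Side.K? bigger) (¬? ∘ Side.K? side) (_∘ inj₂)
                (proj₁ (proj₂ Ss)) λ ¬s → ¬s (inj₁ refl)))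
        where bigger = enlarge side Fw Ss ¬ws
      ... | no stuck = conclude side λ {w} {s} Fw Ss → decidable-stable (w ∼? s) λ ¬ws →
              stuck (w , s , Fw , Ss , ¬ws)

      find-step : ∃ A → Found A
      find-step (z , Az) with any? (λ u → any? λ v → A? u ×-dec A? v ×-dec ¬? (u ≟ v) ×-dec ¬? (u ∼? v))
      ... | no complete = inj₁ (z , Az , λ {x} {y} Ax Ay _ _ x≢y → decidable-stable (x ∼? y) λ ¬xy →
              complete (x , y , Ax , Ay , x≢y , ¬xy))
      ... | yes (u , v , Au , Av , u≢v , ¬uv) = grow side (<-wellFounded _)
        where
        side : Side A u (_≡ v)
        side = record
          { v∈A = Au ; K? = _≟ v ; K⊆A = λ { refl → Av } ; inhabited = v , refl ; v∉K = u≢v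
          ; apart = λ { (_ , refl , uv) → ¬uv uv } ; linked = linked-singleton v }

    find : ∀ {A} (A? : Decidable A) → Acc ℕ._<_ (size A?) → ∃ A → Found A
    find A? (acc rs) = find-step A? λ B? B<A → find B? (rs B<A)

    removable : ∀ {A} → Decidable A → ∃ A → Removable G A
    removable A? inhabited with find A? (<-wellFounded _) inhabited
    ... | inj₁ (_ , simplicial)  = simplicial-removable A? simplicial
    ... | inj₂ (_ , pent , c∈A) = pentagon-removable A? pent c∈A

    -- Induction over removable sets, and translation into walks.

    module _ {k ℓ : ℕ} (v₀ : Fin n) (γ : Fin n → Fin k) (γ-proper : Proper G γ) (k<ℓ : k ℕ.< ℓ) where

      connected-on : ∀ {A} (A? : Decidable A) → Acc ℕ._<_ (size A?) → let open Partial G {ℓ} v₀ A in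
        ∀ α β → ProperOn α → ProperOn β → Reach α β
      connected-on {A} A? (acc rs) α β p q with any? A?
      ... | no empty = Partial.reach-≗ G v₀ A p q λ {u} Au → contradiction (u , Au) empty
      ... | yes inhabited = extend (connected-on rest? (rs (size-strict rest? A? proj₁
              (W⊆A (T⊆W (proj₂ R.inhabited))) λ (_ , ¬T) → ¬T (proj₂ R.inhabited)))) α β p q
        where
        R = removable A? inhabited
        module R = Removable R
        open R using (W⊆A; T⊆W)
        open Removal G v₀ A? R γ γ-proper k<ℓ

  module _ {ℓ : ℕ} (v₀ : Fin n) where
    open Partial G {ℓ} v₀ (λ _ → ⊤)
    open Reconfiguration G ℓ

    walk-resp : ∀ {α β δ} → α ≈ β → Walk β δ → Walk α δ
    walk-resp eq (stop eq′) = stop λ u → trans (eq u) (eq′ u)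
    walk-resp eq (step (v , neq , unique) w) = step
      (v , (λ eq′ → neq (trans (sym (eq v)) eq′)) , λ neq′ → unique λ eq′ → neq′ (trans (eq _) eq′)) w

    reach⇒walk : ∀ (α β : Colouring G ℓ) → Reach (colour α) (colour β) → Walk α β
    reach⇒walk α β r = go r (proper α)
      where
      go : ∀ {f} → Reach f (colour β) → (p : Proper G f) → Walk (record { colour = f ; proper = p }) β
      go ε p = stop λ _ → refl
      go {f} (_◅_ {j = g} (_ , q , v , same) r) p with f v ≟ g v
      -- A step that changes nothing is dropped, since adjacency demands exactly one differing
      -- vertex.
      ... | yes eq = walk-resp f≈g (go r λ _ _ → q tt tt)
        where
        f≈g : ∀ u → f u ≡ g u
        f≈g u with u ≟ v
        ... | yes refl = eq
        ... | no u≢v   = same tt u≢v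
      ... | no neq = step (v , neq , λ {u} neq′ → sym (decidable-stable (u ≟ v) λ u≢v →
              neq′ (same tt u≢v))) (go r λ _ _ → q tt tt)

theorem8 : ∀ {n : ℕ} (G : Graph n) → Free (P 5) (C 4) G →
    ∀ (ℓ : ℕ) → ℓ ≥ χ G + 1 → Reconfiguration.Connected G ℓ
-- The empty graph has no vertex to serve as `v₀`, and its colourings agree trivially.
theorem8 {ℕ.zero} G _ ℓ _ α β = Reconfiguration.stop λ ()
theorem8 {ℕ.suc n} G free ℓ ℓ≥χ+1 α β = reach⇒walk G 0F α β
  (Structure.connected-on G free 0F (colour γ) (proper γ) χ<ℓ (λ _ → yes tt) (<-wellFounded _)
    (colour α) (colour β) (λ _ _ → proper α _ _) (λ _ _ → proper β _ _))
  where
  γ = proj₁ (χ-least G)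
  χ<ℓ : χ G ℕ.< ℓ
  χ<ℓ = subst (ℕ._≤ ℓ) (ℕ.+-comm (χ G) 1) ℓ≥χ+1
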